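{- For all integers $n\ge 1$ and $k\ge 0$, $$|\mathcal{EM}(n,k)|=|\mathcal{OM}(n,k)|=|\mathcal{RM}(n,k)|.$$
   Context: All matrices are square (of dimension at least $1$) with nonnegative integer entries; the dimension of a matrix is its number of rows, rows and columns are numbered starting from $1$ (top to bottom, left to right), and $M_{i,j}$ is the entry in row $i$, column $j$. The size of a matrix is the sum of all its entries; the sum of a row (column) is the sum of the entries in it. A Fishburn matrix is an upper-triangular matrix of nonnegative integers in which every row and every column contains a nonzero entry. The dual $\overline{M}$ of a matrix $M$ of dimension $m$ is defined by $\overline{M}_{i,j}=M_{m+1-j,\,m+1-i}$ for $1\le i,j\le m$; $M$ is self-dual if $M=\overline{M}$. In a matrix of dimension $m$, a cell $(i,j)$ is a diagonal cell if $i+j=m+1$, an NW-cell if $i+j<m+1$, and an SE-cell if $i+j>m+1$. The reduced size of a self-dual Fishburn matrix is the sum of the entries in all its diagonal cells and NW-cells. $\mathcal{EM}(n,k)$ (resp. $\mathcal{OM}(n,k)$) is the set of self-dual Fishburn matrices of reduced size $n$ whose first row has sum $k$ and whose dimension is even (resp. odd). A row-Fishburn matrix is an upper-triangular matrix of nonnegative integers in which every row contains a nonzero entry. $\mathcal{RM}(n,k)$ is the set of row-Fishburn matrices of size $n$ whose last column has sum $k$. -}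

module Defs where

open import Level using (_⊔_)
open import Data.Nat.Base using (ℕ; suc; _+_; _<_)
open import Data.Nat.Divisibility using (_∣_; _∤_)
open import Data.Nat.Properties using (_≟_; _<?_; +-0-commutativeMonoid)
import Data.Fin.Base as Fin
open Fin using (Fin; toℕ; fromℕ; opposite)
open import Data.Vec.Base using (Vec; lookup; tabulate)
open import Data.Product.Base using (Σ; ∃; proj₁)
open import Data.Sum.Base using (_⊎_)
open import Data.Bool.Base using (if_then_else_)
open import Function.Bundles using (Inverse)
open import Relation.Binary.Bundles using (Setoid)
import Relation.Binary.Construct.On as On
open import Relation.Binary.PropositionalEquality using (_≡_; _≢_; setoid)
open import Relation.Nullary.Decidable using (Dec; does; _⊎-dec_)
open import Relation.Unary using (Pred)
open import Algebra.Properties.CommutativeMonoid.Sum +-0-commutativeMonoid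
  using (sum-syntax)

Matrix : ℕ → Set
Matrix m = Vec (Vec ℕ m) m

entry : ∀ {m} → Matrix m → Fin m → Fin m → ℕ
entry M i j = lookup (lookup M i) j

rowSum : ∀ {m} → Matrix m → Fin m → ℕ
rowSum {m} M i = ∑[ j < m ] entry M i j

colSum : ∀ {m} → Matrix m → Fin m → ℕ
colSum {m} M j = ∑[ i < m ] entry M i j

size : ∀ {m} → Matrix m → ℕ
size {m} M = ∑[ i < m ] ∑[ j < m ] entry M i j

UpperTriangular : ∀ {m} → Matrix m → Set
UpperTriangular M = ∀ i j → j Fin.< i → entry M i j ≡ 0

NonzeroRows : ∀ {m} → Matrix m → Set
NonzeroRows M = ∀ i → ∃ λ j → entry M i j ≢ 0

NonzeroColumns : ∀ {m} → Matrix m → Set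
NonzeroColumns M = ∀ j → ∃ λ i → entry M i j ≢ 0

record IsFishburn {m} (M : Matrix m) : Set where
  field
    upperTriangular : UpperTriangular M
    nonzeroRows     : NonzeroRows M
    nonzeroColumns  : NonzeroColumns M

record IsRowFishburn {m} (M : Matrix m) : Set where
  field
    upperTriangular : UpperTriangular M
    nonzeroRows     : NonzeroRows M

-- opposite sends the k-th element of Fin m to the (m + 1 - k)-th.
dual : ∀ {m} → Matrix m → Matrix m
dual M = tabulate λ i → tabulate λ j → entry M (opposite j) (opposite i)

SelfDual : ∀ {m} → Matrix m → Set
SelfDual M = M ≡ dual M

-- The 1-based number of a row or column.
number : ∀ {m} → Fin m → ℕ
number i = suc (toℕ i)

DiagonalCell : ∀ {m} → Fin m → Fin m → Set
DiagonalCell {m} i j = number i + number j ≡ m + 1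

NWCell : ∀ {m} → Fin m → Fin m → Set
NWCell {m} i j = number i + number j < m + 1

diagonalOrNWCell? : ∀ {m} (i j : Fin m) → Dec (DiagonalCell i j ⊎ NWCell i j)
diagonalOrNWCell? {m} i j =
  (number i + number j ≟ m + 1) ⊎-dec (number i + number j <? m + 1)

reducedSize : ∀ {m} → Matrix m → ℕ
reducedSize {m} M =
  ∑[ i < m ] ∑[ j < m ] (if does (diagonalOrNWCell? i j) then entry M i j else 0)

-- Square matrices of arbitrary positive dimension: (d , M) has dimension suc d.
SquareMatrix : Set
SquareMatrix = Σ ℕ λ d → Matrix (suc d)

record IsSelfDualFishburn (n k : ℕ) {d : ℕ} (M : Matrix (suc d)) : Set where
  field
    isFishburn   : IsFishburn M
    selfDual     : SelfDual M
    reducedSize≡ : reducedSize M ≡ n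
    firstRowSum≡ : rowSum M Fin.zero ≡ k

record EM (n k : ℕ) (A : SquareMatrix) : Set where
  constructor mkEM
  open Σ A renaming (proj₁ to d; proj₂ to M)
  field
    isSelfDualFishburn : IsSelfDualFishburn n k M
    evenDimension      : 2 ∣ suc d

record OM (n k : ℕ) (A : SquareMatrix) : Set where
  constructor mkOM
  open Σ A renaming (proj₁ to d; proj₂ to M)
  field
    isSelfDualFishburn : IsSelfDualFishburn n k M
    oddDimension       : 2 ∤ suc d

record RM (n k : ℕ) (A : SquareMatrix) : Set where
  constructor mkRM
  open Σ A renaming (proj₁ to d; proj₂ to M)
  field
    isRowFishburn  : IsRowFishburn M
    size≡          : size M ≡ n
    lastColumnSum≡ : colSum M (fromℕ d) ≡ k

-- The elements of A satisfying P, compared as elements of A: the proofs of P,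
-- which need not be unique, are ignored.
subsetSetoid : ∀ {a p} {A : Set a} → Pred A p → Setoid (a ⊔ p) a
subsetSetoid {A = A} P = On.setoid {B = Σ A P} (setoid A) proj₁

HasCardinality : ∀ {a p} {A : Set a} → Pred A p → ℕ → Set (a ⊔ p)
HasCardinality P c = Inverse (subsetSetoid P) (setoid (Fin c))

{-# OPTIONS --safe #-}

-- A self-dual matrix is determined by its cells in the upper triangle that are
-- diagonal or NW-cells. Column j of this region together with column m + 1 - j
-- gives a pair (u , v) of vectors of length j, and the matrix has no zero row iff
-- every u is nonzero and, for every j, the cells of row j in the region together
-- with v are not all zero (the "hook" condition). For odd m the middle column is a
-- single nonzero vector. A row-Fishburn matrix, read from its last row upwards, is
-- just a sequence of nonzero vectors of lengths 1, 2, 3, ...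
--
-- Consider the pairs of columns from j = r + 1 on, preceded by one more vector v
-- of length r. If v = 0, then the first u is an arbitrary nonzero vector of length
-- r + 1, and what follows it is again a vector and a sequence of pairs, subject to
-- the hook condition. If v is nonzero, then (0 , v) plays the role of u, and
-- inserting a zero row r + 1 into the remaining columns gives exactly the
-- configurations violating the hook condition. So in both cases a nonzero vector
-- of length r + 1 is split off with no condition left, and iterating this turns
-- self-dual matrices of either parity into sequences of nonzero vectors.
module Submission where

open import Level using (0ℓ)
open import Data.Nat.Base using (ℕ; zero; suc; _+_; _*_; parity; _≤_; _<_; s≤s; z≤n)
open import Data.Nat.Properties
open import Data.Nat.Divisibility using (_∣_; _∤_; divides)
open import Data.Nat.Tactic.RingSolver using (solve-∀)
open import Data.Bool.Base using (true; false; if_then_else_)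
import Data.Fin.Base as Fin
open Fin using (Fin; zero; suc; fromℕ; inject₁; opposite; toℕ; punchIn)
open import Data.Fin.Properties using (toℕ-inject₁; toℕ-fromℕ; toℕ<n; opposite-involutive)
open import Data.Fin.Relation.Unary.Top using (view; ‵fromℕ; ‵inject₁; view-fromℕ; view-inject₁)
open import Data.List.Base as List using (List; []; _∷_)
open import Data.List.Membership.Propositional using (_∈_)
open import Data.List.Membership.Propositional.Properties
  using (∈-lookup; ∈-filter⁺; ∈-filter⁻; ∈-deduplicate⁺; ∈-deduplicate⁻; ∈-cartesianProductWith⁺; ∈-upTo⁺)
open import Data.List.Membership.Propositional.Properties.WithK using (unique⇒irrelevant)
open import Data.List.Relation.Unary.Any using (here; there; index)
open import Data.List.Relation.Unary.Any.Properties using (lookup-index)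
import Data.List.Relation.Unary.Unique.DecPropositional.Properties as Unique
open import Data.Maybe.Base using (Maybe; just; nothing)
open import Data.Parity.Base using (Parity; 0ℙ; 1ℙ)
open import Data.Product.Base using (∃; _×_; _,_; proj₁; proj₂)
open import Data.Sum.Base using (_⊎_; inj₁; inj₂)
open import Data.Unit.Base using (⊤; tt)
open import Data.Vec.Base
  using (Vec; []; _∷_; lookup; tabulate; head; tail; map; replicate; insertAt; removeAt)
open import Data.Vec.Functional using () renaming (_∷_ to _∷ᶠ_)
open import Data.Vec.Properties
  using (insertAt-punchIn; insertAt-lookup; insertAt-removeAt; removeAt-insertAt; lookup-map;
         map-∘; map-id; ≡-dec; lookup∘tabulate; tabulate∘lookup; tabulate-cong)
open import Function.Base using (_∘_; id)
open import Function.Bundles using (Inverse; mk⇔)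
open import Function.Construct.Composition using (inverse)
open import Relation.Nullary using (yes; no; contradiction)
open import Relation.Nullary.Decidable using (does; dec-true; dec-false; does-⇔; _×-dec_; ¬?; map′)
open import Relation.Unary using (Pred; Decidable)
open import Relation.Binary.Definitions using (DecidableEquality)
open import Relation.Binary.PropositionalEquality
open import Algebra.Properties.CommutativeMonoid.Sum +-0-commutativeMonoid
  using (sum; sum-syntax; sum-cong-≗; sum-replicate-zero; sum-init-last; ∑-distrib-+)
open import Defs

private variable m n r : ℕ

-- Weights of vectors and insertion of zero entries

weight : Vec ℕ r → ℕ
weight v = sum (lookup v)

zeros : Vec ℕ r
zeros = replicate _ 0

weight-zeros : ∀ r → weight (zeros {r}) ≡ 0
weight-zeros zero    = refl
weight-zeros (suc r) = weight-zeros r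

weight≡0⇒zeros : (v : Vec ℕ r) → weight v ≡ 0 → v ≡ zeros
weight≡0⇒zeros []      _  = refl
weight≡0⇒zeros (x ∷ v) eq =
  cong₂ _∷_ (m+n≡0⇒m≡0 x eq) (weight≡0⇒zeros v (m+n≡0⇒n≡0 x eq))

weight-insertAt : (v : Vec ℕ r) (i : Fin (suc r)) → weight (insertAt v i 0) ≡ weight v
weight-insertAt v       zero    = refl
weight-insertAt (x ∷ v) (suc i) = cong (x +_) (weight-insertAt v i)

insertAt-removeAt-0 : (v : Vec ℕ (suc r)) (i : Fin (suc r)) → lookup v i ≡ 0 →
                      insertAt (removeAt v i) i 0 ≡ v
insertAt-removeAt-0 v i eq =
  trans (cong (insertAt _ i) (sym eq)) (insertAt-removeAt v i)

lookup-zeros : (i : Fin r) → lookup zeros i ≡ 0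
lookup-zeros zero    = refl
lookup-zeros (suc i) = lookup-zeros i

-- Pairs of columns and the insertion of empty rows

-- The self-dual matrices of dimension m below r further rows: Cols m r lists the
-- pairs of columns from the outside inwards. The head of a column is the cell in
-- the row that the column adds, so the topmost row is the last entry.
data Cols : ℕ → ℕ → Set where
  []   : Cols 0 r
  end  : Vec ℕ (suc r) → Cols 1 r
  cons : Vec ℕ (suc r) → Vec ℕ (suc r) → Cols m (suc r) → Cols (2 + m) r

total : Cols m r → ℕ
total []           = 0
total (end u)      = weight u
total (cons u v c) = weight u + (weight v + total c)

-- Index `i` counts the rows above from the nearest one outwards. It grows by one with each pair,
-- since the row added by that pair takes index `zero`.
row : Cols m r → Fin r → ℕ
row []           i = 0
row (end u)      i = lookup u (suc i)
row (cons u v c) i = lookup u (suc i) + (lookup v (suc i) + row c (suc i))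

-- The full sum of the row that the pair adds: the head of `v` is its diagonal cell, and the tail of
-- `v` reflects onto its SE-cells.
hook : Vec ℕ (suc r) → Vec ℕ (suc r) → Cols m (suc r) → ℕ
hook u v c = head u + (weight v + row c zero)

-- By upper triangularity `u` holds all of its column that can be nonzero, and it reflects onto a
-- row of the other half. So `weight u ≢ 0` settles that row, and `hook u v c ≢ 0` the row added by
-- the pair.
Valid : Cols m r → Set
Valid []           = ⊤
Valid (end u)      = weight u ≢ 0
Valid (cons u v c) = weight u ≢ 0 × hook u v c ≢ 0 × Valid c

insertRow : Fin (suc r) → Cols m r → Cols m (suc r)
insertRow i []           = []
insertRow i (end u)      = end (insertAt u (suc i) 0)
insertRow i (cons u v c) =
  cons (insertAt u (suc i) 0) (insertAt v (suc i) 0) (insertRow (suc i) c)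

removeRow : Fin (suc r) → Cols m (suc r) → Cols m r
removeRow i []           = []
removeRow i (end u)      = end (removeAt u (suc i))
removeRow i (cons u v c) =
  cons (removeAt u (suc i)) (removeAt v (suc i)) (removeRow (suc i) c)

total-insertRow : ∀ i (c : Cols m r) → total (insertRow i c) ≡ total c
total-insertRow i []           = refl
total-insertRow i (end u)      = weight-insertAt u (suc i)
total-insertRow i (cons u v c) =
  cong₂ _+_ (weight-insertAt u (suc i))
    (cong₂ _+_ (weight-insertAt v (suc i)) (total-insertRow (suc i) c))

row-insertRow-punchIn : ∀ i (c : Cols m r) j → row (insertRow i c) (punchIn i j) ≡ row c j
row-insertRow-punchIn i []           j = refl
row-insertRow-punchIn i (end u)      j = insertAt-punchIn u (suc i) 0 (suc j)
row-insertRow-punchIn i (cons u v c) j =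
  cong₂ _+_ (insertAt-punchIn u (suc i) 0 (suc j))
    (cong₂ _+_ (insertAt-punchIn v (suc i) 0 (suc j)) (row-insertRow-punchIn (suc i) c (suc j)))

row-insertRow : ∀ i (c : Cols m r) → row (insertRow i c) i ≡ 0
row-insertRow i []           = refl
row-insertRow i (end u)      = insertAt-lookup u (suc i) 0
row-insertRow i (cons u v c) =
  cong₂ _+_ (insertAt-lookup u (suc i) 0)
    (cong₂ _+_ (insertAt-lookup v (suc i) 0) (row-insertRow (suc i) c))

removeRow-insertRow : ∀ i (c : Cols m r) → removeRow i (insertRow i c) ≡ c
removeRow-insertRow i []           = refl
removeRow-insertRow i (end u)      = cong end (removeAt-insertAt u (suc i) 0)
removeRow-insertRow i (cons u v c)
  rewrite removeAt-insertAt u (suc i) 0 | removeAt-insertAt v (suc i) 0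
        | removeRow-insertRow (suc i) c = refl

-- A sum of natural numbers vanishes only if every summand does, so an empty row can be cut out
-- without loss.
insertRow-removeRow : ∀ i (c : Cols m (suc r)) → row c i ≡ 0 → insertRow i (removeRow i c) ≡ c
insertRow-removeRow i []           eq = refl
insertRow-removeRow i (end u)      eq = cong end (insertAt-removeAt-0 u (suc i) eq)
insertRow-removeRow i (cons u v c) eq
  rewrite insertAt-removeAt-0 u (suc i) (m+n≡0⇒m≡0 _ eq)
        | insertAt-removeAt-0 v (suc i) (m+n≡0⇒m≡0 _ (m+n≡0⇒n≡0 (lookup u (suc i)) eq))
        | insertRow-removeRow (suc i) c
            (m+n≡0⇒n≡0 (lookup v (suc i)) (m+n≡0⇒n≡0 (lookup u (suc i)) eq)) = refl

hook-insertRow : ∀ i (u v : Vec ℕ (suc r)) (c : Cols m (suc r)) →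
  hook (insertAt u (suc i) 0) (insertAt v (suc i) 0) (insertRow (suc i) c) ≡ hook u v c
hook-insertRow i u@(_ ∷ _) v c =
  cong (head u +_) (cong₂ _+_ (weight-insertAt v (suc i)) (row-insertRow-punchIn (suc i) c zero))

Valid-insertRow⁺ : ∀ i (c : Cols m r) → Valid c → Valid (insertRow i c)
Valid-insertRow⁺ i []           _ = tt
Valid-insertRow⁺ i (end u)      p = subst (_≢ 0) (sym (weight-insertAt u (suc i))) p
Valid-insertRow⁺ i (cons u v c) (p , q , s) =
  subst (_≢ 0) (sym (weight-insertAt u (suc i))) p ,
  subst (_≢ 0) (sym (hook-insertRow i u v c)) q ,
  Valid-insertRow⁺ (suc i) c s

Valid-insertRow⁻ : ∀ i (c : Cols m r) → Valid (insertRow i c) → Valid c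
Valid-insertRow⁻ i []           _ = tt
Valid-insertRow⁻ i (end u)      p = subst (_≢ 0) (weight-insertAt u (suc i)) p
Valid-insertRow⁻ i (cons u v c) (p , q , s) =
  subst (_≢ 0) (weight-insertAt u (suc i)) p ,
  subst (_≢ 0) (hook-insertRow i u v c) q ,
  Valid-insertRow⁻ (suc i) c s

Valid-removeRow : ∀ i (c : Cols m (suc r)) → row c i ≡ 0 → Valid c → Valid (removeRow i c)
Valid-removeRow i c eq p =
  Valid-insertRow⁻ i _ (subst Valid (sym (insertRow-removeRow i c eq)) p)

-- Sequences of nonzero vectors and their bijection with pairs of columns

data Seq : ℕ → Set where
  []  : Seq r
  _∷_ : Vec ℕ (suc r) → Seq (suc r) → Seq r

totalˢ : Seq r → ℕ
totalˢ []      = 0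
totalˢ (u ∷ s) = weight u + totalˢ s

rowˢ : Seq r → Fin r → ℕ
rowˢ []      i = 0
rowˢ (u ∷ s) i = lookup u (suc i) + rowˢ s (suc i)

Validˢ : Seq r → Set
Validˢ []      = ⊤
Validˢ (u ∷ s) = weight u ≢ 0 × Validˢ s

mutual
  -- The recursion is on the dimension `m`, because `insertRow zero c` is no subterm of `c`.
  flatten : ∀ m {r} → Cols m r → Seq r
  flatten zero          []           = []
  flatten (suc zero)    (end u)      = u ∷ []
  flatten (suc (suc m)) (cons u v c) = u ∷ flattenWith m v c

  flattenWith : ∀ m {r} → Vec ℕ r → Cols m r → Seq r
  flattenWith m v c with weight v ≟ 0
  ... | yes _ = flatten m c
  -- The vector split off has length `r + 1`; its head 0 belongs to the same new row that is
  -- inserted empty into `c`.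
  ... | no  _ = (0 ∷ v) ∷ flatten m (insertRow zero c)

-- The dimension is existential because `unstep`, given a continuation, keeps it or raises it by 2
-- depending on the entries.
PrefixedCols : ℕ → Set
PrefixedCols r = Vec ℕ r × ∃ λ m → Cols m r

-- A pair violating the hook condition comes from a nonzero prefix, which was
-- turned into 0 ∷ v by flattenWith. The case nothing stands for the empty
-- continuation, where u is the middle column of a matrix of odd dimension.
unstep : Vec ℕ (suc r) → Maybe (PrefixedCols (suc r)) → PrefixedCols r
unstep u nothing            = zeros , 1 , end u
unstep u (just (v , m , c)) with hook u v c ≟ 0
... | yes _ = tail u , m , removeRow zero c
... | no  _ = zeros , 2 + m , cons u v c

-- Parity is decided at the end of the sequence: for even dimension an empty matrix follows, for odd
-- dimension the last vector is taken as a middle column.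
unflatten[] : Parity → Maybe (PrefixedCols r)
unflatten[] 0ℙ = just (zeros , 0 , [])
unflatten[] 1ℙ = nothing

unflatten : Parity → Seq r → Maybe (PrefixedCols r)
unflatten b []      = unflatten[] b
unflatten b (u ∷ s) = just (unstep u (unflatten b s))

flattenMaybe : Maybe (PrefixedCols r) → Seq r
flattenMaybe nothing            = []
flattenMaybe (just (v , m , c)) = flattenWith m v c

flattenWith-zeros : ∀ {m r} (c : Cols m r) → flattenWith m zeros c ≡ flatten m c
flattenWith-zeros {m} {r} c with weight (zeros {r}) ≟ 0
... | yes _ = refl
... | no ≢0 = contradiction (weight-zeros r) ≢0

hook≡0⇒ : ∀ (u v : Vec ℕ (suc r)) (c : Cols m (suc r)) → hook u v c ≡ 0 →
          head u ≡ 0 × v ≡ zeros × row c zero ≡ 0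
hook≡0⇒ u v c eq =
  m+n≡0⇒m≡0 _ eq ,
  weight≡0⇒zeros v (m+n≡0⇒m≡0 _ (m+n≡0⇒n≡0 (head u) eq)) ,
  m+n≡0⇒n≡0 (weight v) (m+n≡0⇒n≡0 (head u) eq)

-- If the hook vanishes, then `u` starts with 0, `v` is zero and row `zero` of `c` is empty, so
-- `flattenWith` on `tail u` puts back the row that `unstep` removed.
flatten-unstep : ∀ (u : Vec ℕ (suc r)) x → weight u ≢ 0 →
                 flattenMaybe (just (unstep u x)) ≡ u ∷ flattenMaybe x
flatten-unstep u nothing u≢0 = flattenWith-zeros (end u)
flatten-unstep u (just (v , m , c)) u≢0 with hook u v c ≟ 0
... | no  _  = flattenWith-zeros (cons u v c)
... | yes eq with hook≡0⇒ u v c eq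
flatten-unstep (0 ∷ u) (just (_ , m , c)) u≢0 | yes eq | refl , refl , c₀
  -- All the weight of `0 ∷ u` lies in `u`, so `flattenWith` takes the inserting branch.
  with weight u ≟ 0
... | yes u≡0 = contradiction u≡0 u≢0
... | no  _   = cong ((0 ∷ u) ∷_)
                  (trans (cong (flatten m) (insertRow-removeRow zero c c₀))
                         (sym (flattenWith-zeros c)))

flatten-unflatten : ∀ b (s : Seq r) → Validˢ s → flattenMaybe (unflatten b s) ≡ s
flatten-unflatten 0ℙ []      _ = flattenWith-zeros []
flatten-unflatten 1ℙ []      _ = refl
flatten-unflatten b (u ∷ s) (p , q) =
  trans (flatten-unstep u (unflatten b s) p) (cong (u ∷_) (flatten-unflatten b s q))

unstep-hook≢0 : ∀ (u v : Vec ℕ (suc r)) (c : Cols m (suc r)) → hook u v c ≢ 0 →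
                unstep u (just (v , m , c)) ≡ (zeros , 2 + m , cons u v c)
unstep-hook≢0 u v c ≢0 with hook u v c ≟ 0
... | yes eq = contradiction eq ≢0
... | no  _  = refl

-- The head 0, the zero second column and the inserted empty row make the hook vanish, which is how
-- `unstep` recognises a former prefix.
unstep-insertRow : ∀ (v : Vec ℕ r) (c : Cols m r) →
  unstep (0 ∷ v) (just (zeros , m , insertRow zero c)) ≡ (v , m , c)
unstep-insertRow {r} v c with hook (0 ∷ v) zeros (insertRow zero c) ≟ 0
... | yes _ = cong (λ c → v , _ , c) (removeRow-insertRow zero c)
... | no ≢0 = contradiction (cong₂ _+_ (weight-zeros r) (row-insertRow zero c)) ≢0

mutual
  -- Validity supplies the hook condition, which keeps a genuine pair from being mistaken for a
  -- former prefix. The parity is passed on unchanged, as `parity (2 + m)` is `parity m`.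
  unflatten-flatten : ∀ m (c : Cols m r) → Valid c →
    unflatten (parity m) (flatten m c) ≡ just (zeros , m , c)
  unflatten-flatten zero          []           _ = refl
  unflatten-flatten (suc zero)    (end u)      _ = refl
  unflatten-flatten (suc (suc m)) (cons u v c) (_ , q , p) = begin
    just (unstep u (unflatten (parity m) (flattenWith m v c)))
      ≡⟨ cong (λ x → just (unstep u x)) (unflatten-flattenWith m v c p) ⟩
    just (unstep u (just (v , m , c)))
      ≡⟨ cong just (unstep-hook≢0 u v c q) ⟩
    just (zeros , 2 + m , cons u v c) ∎
    where open ≡-Reasoning

  unflatten-flattenWith : ∀ m (v : Vec ℕ r) (c : Cols m r) → Valid c →
    unflatten (parity m) (flattenWith m v c) ≡ just (v , m , c)
  unflatten-flattenWith m v c p with weight v ≟ 0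
  ... | yes v≡0 rewrite weight≡0⇒zeros v v≡0 = unflatten-flatten m c p
  ... | no  _   = begin
    just (unstep (0 ∷ v) (unflatten (parity m) (flatten m (insertRow zero c))))
      ≡⟨ cong (λ x → just (unstep (0 ∷ v) x))
           (unflatten-flatten m (insertRow zero c) (Valid-insertRow⁺ zero c p)) ⟩
    just (unstep (0 ∷ v) (just (zeros , m , insertRow zero c)))
      ≡⟨ cong just (unstep-insertRow v c) ⟩
    just (v , m , c) ∎
    where open ≡-Reasoning

mutual
  total-flatten : ∀ m (c : Cols m r) → totalˢ (flatten m c) ≡ total c
  total-flatten zero          []           = refl
  total-flatten (suc zero)    (end u)      = +-identityʳ _
  total-flatten (suc (suc m)) (cons u v c) = cong (weight u +_) (total-flattenWith m v c)

  total-flattenWith : ∀ m (v : Vec ℕ r) (c : Cols m r) →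
    totalˢ (flattenWith m v c) ≡ weight v + total c
  total-flattenWith m v c with weight v ≟ 0
  ... | yes v≡0 = trans (total-flatten m c) (cong (_+ total c) (sym v≡0))
  ... | no  _   = cong (weight v +_)
                    (trans (total-flatten m (insertRow zero c)) (total-insertRow zero c))

mutual
  row-flatten : ∀ m (c : Cols m r) i → rowˢ (flatten m c) i ≡ row c i
  row-flatten zero          []           i = refl
  row-flatten (suc zero)    (end u)      i = +-identityʳ _
  row-flatten (suc (suc m)) (cons u v c) i =
    cong (lookup u (suc i) +_) (row-flattenWith m v c (suc i))

  row-flattenWith : ∀ m (v : Vec ℕ r) (c : Cols m r) i →
    rowˢ (flattenWith m v c) i ≡ lookup v i + row c i
  row-flattenWith m v c i with weight v ≟ 0
  ... | yes v≡0 rewrite weight≡0⇒zeros v v≡0 | lookup-zeros i = row-flatten m c i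
  ... | no  _   = cong (lookup v i +_)
                    (trans (row-flatten m (insertRow zero c) (suc i))
                           (row-insertRow-punchIn zero c i))

mutual
  Valid-flatten : ∀ m (c : Cols m r) → Valid c → Validˢ (flatten m c)
  Valid-flatten zero          []           _           = tt
  Valid-flatten (suc zero)    (end u)      p           = p , tt
  Valid-flatten (suc (suc m)) (cons u v c) (p , _ , q) = p , Valid-flattenWith m v c q

  Valid-flattenWith : ∀ m (v : Vec ℕ r) (c : Cols m r) → Valid c → Validˢ (flattenWith m v c)
  Valid-flattenWith m v c p with weight v ≟ 0
  ... | yes _   = Valid-flatten m c p
  ... | no  v≢0 = v≢0 , Valid-flatten m (insertRow zero c) (Valid-insertRow⁺ zero c p)

WellFormed : Parity → Maybe (PrefixedCols r) → Set
WellFormed b nothing            = b ≡ 1ℙ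
WellFormed b (just (_ , m , c)) = parity m ≡ b × Valid c

-- Given a continuation, `unstep` keeps the dimension or adds 2, so parity survives. Cutting out an
-- empty row keeps validity; otherwise the failed test is itself the required hook condition.
WellFormed-unstep : ∀ b (u : Vec ℕ (suc r)) x → weight u ≢ 0 → WellFormed b x →
  WellFormed b (just (unstep u x))
WellFormed-unstep b u nothing            u≢0 eq       = sym eq , u≢0
WellFormed-unstep b u (just (v , m , c)) u≢0 (eq , p) with hook u v c ≟ 0
... | yes h≡0 = eq , Valid-removeRow zero c (proj₂ (proj₂ (hook≡0⇒ u v c h≡0))) p
... | no  h≢0 = eq , u≢0 , h≢0 , p

WellFormed-unflatten : ∀ b (s : Seq r) → Validˢ s → WellFormed b (unflatten b s)
WellFormed-unflatten 0ℙ []      _       = refl , tt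
WellFormed-unflatten 1ℙ []      _       = refl
WellFormed-unflatten b (u ∷ s) (p , q) = WellFormed-unstep b u (unflatten b s) p (WellFormed-unflatten b s q)

-- Bijections between subsets and finite cardinality

-- The maps live on the whole types but are inverse only on the subsets, so junk values elsewhere
-- are harmless.
record Correspondence {A B : Set} (P : Pred A 0ℓ) (Q : Pred B 0ℓ) : Set where
  field
    to      : A → B
    from    : B → A
    to-∈    : ∀ {a} → P a → Q (to a)
    from-∈  : ∀ {b} → Q b → P (from b)
    from-to : ∀ {a} → P a → from (to a) ≡ a
    to-from : ∀ {b} → Q b → to (from b) ≡ b

cardinality-transport : ∀ {A B : Set} {P : Pred A 0ℓ} {Q : Pred B 0ℓ} {c} →
  Correspondence P Q → HasCardinality Q c → HasCardinality P c
cardinality-transport {P = P} {Q} F = inverse subset-inverse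
  where
  open Correspondence F
  subset-inverse : Inverse (subsetSetoid P) (subsetSetoid Q)
  subset-inverse = record
    { to        = λ (a , p) → to a , to-∈ p
    ; from      = λ (b , q) → from b , from-∈ q
    ; to-cong   = cong to
    ; from-cong = cong from
    ; inverse   = (λ { {_ , q} eq → trans (cong to eq) (to-from q) })
                , (λ { {_ , p} eq → trans (cong from eq) (from-to p) })
    }

index-∈-lookup : ∀ {A : Set} (xs : List A) i → index (∈-lookup {xs = xs} i) ≡ i
index-∈-lookup (x ∷ xs) zero    = refl
index-∈-lookup (x ∷ xs) (suc i) = cong suc (index-∈-lookup xs i)

-- `subsetSetoid` ignores proofs of `P`, so the position of an element must not depend on its
-- membership proof; in a list without duplicates that proof is unique.
listed⇒finite : ∀ {A : Set} {P : Pred A 0ℓ} → DecidableEquality A → Decidable P →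
  (xs : List A) → (∀ {a} → P a → a ∈ xs) → ∃ (HasCardinality P)
listed⇒finite {A} {P} _≟A_ P? xs complete = List.length ys , record
  { to        = λ (_ , p) → index (∈ys p)
  ; from      = λ i → List.lookup ys i , P-lookup i
  ; to-cong   = λ { {_ , p} {_ , q} refl → index-cong (∈ys p) (∈ys q) }
  ; from-cong = cong (List.lookup ys)
  ; inverse   = (λ { {i} {_ , p} refl → trans (index-cong (∈ys p) (∈-lookup i)) (index-∈-lookup ys i) })
              , (λ { {_ , p} refl → sym (lookup-index (∈ys p)) })
  }
  where
  ys : List A
  ys = List.deduplicate _≟A_ (List.filter P? xs)

  ∈ys : ∀ {a} → P a → a ∈ ys
  ∈ys p = ∈-deduplicate⁺ _≟A_ (∈-filter⁺ P? (complete p) p)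

  P-lookup : ∀ i → P (List.lookup ys i)
  P-lookup i = proj₂ (∈-filter⁻ P? {xs = xs} (∈-deduplicate⁻ _≟A_ (List.filter P? xs) (∈-lookup i)))

  index-cong : ∀ {a} (p q : a ∈ ys) → index p ≡ index q
  index-cong p q = cong index
    (unique⇒irrelevant (Unique.deduplicate-! _≟A_ (List.filter P? xs)) p q)

-- Finiteness of the set of sequences with given statistics

-- Adds up the last entries of all the vectors, since the vector of length `j` meets the first row
-- in position `j`. In a row-Fishburn matrix these entries form the last column.
firstRowˢ : Seq 0 → ℕ
firstRowˢ []      = 0
firstRowˢ (u ∷ s) = lookup u zero + rowˢ s zero

record SeqOf (n k : ℕ) (s : Seq 0) : Set where
  field
    valid    : Validˢ s
    total≡   : totalˢ s ≡ n
    firstRow≡ : firstRowˢ s ≡ k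

infix 4 _≟ˢ_
_≟ˢ_ : DecidableEquality (Seq r)
[]      ≟ˢ []      = yes refl
[]      ≟ˢ (_ ∷ _) = no λ ()
(_ ∷ _) ≟ˢ []      = no λ ()
(u ∷ s) ≟ˢ (v ∷ t) = map′ (λ { (refl , refl) → refl }) (λ { refl → refl , refl })
                       (≡-dec _≟_ u v ×-dec (s ≟ˢ t))

Validˢ? : Decidable (Validˢ {r})
Validˢ? []      = yes tt
Validˢ? (u ∷ s) = ¬? (weight u ≟ 0) ×-dec Validˢ? s

SeqOf? : ∀ n k → Decidable (SeqOf n k)
SeqOf? n k s = map′ (λ (p , q , t) → record { valid = p ; total≡ = q ; firstRow≡ = t })
                    (λ x → let open SeqOf x in valid , total≡ , firstRow≡)
                    (Validˢ? s ×-dec (totalˢ s ≟ n) ×-dec (firstRowˢ s ≟ k))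

vecs : ℕ → ∀ r → List (Vec ℕ r)
vecs n zero    = [] ∷ []
vecs n (suc r) = List.cartesianProductWith _∷_ (List.upTo (suc n)) (vecs n r)

∈-vecs : (v : Vec ℕ r) → weight v ≤ n → v ∈ vecs n r
∈-vecs []      _ = here refl
∈-vecs (x ∷ v) p =
  ∈-cartesianProductWith⁺ _∷_ (∈-upTo⁺ (s≤s (m+n≤o⇒m≤o x p))) (∈-vecs v (m+n≤o⇒n≤o x p))

seqs : ℕ → ∀ r → List (Seq r)
seqs zero    r = [] ∷ []
seqs (suc n) r = [] ∷ List.cartesianProductWith _∷_ (vecs (suc n) (suc r)) (seqs n (suc r))

-- Every vector of a valid sequence weighs at least 1, so a sequence of total at most `n` has at
-- most `n` vectors.
∈-seqs : ∀ n (s : Seq r) → Validˢ s → totalˢ s ≤ n → s ∈ seqs n r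
∈-seqs zero    []      _         _  = here refl
∈-seqs (suc n) []      _         _  = here refl
∈-seqs zero    (u ∷ s) (u≢0 , _) le = contradiction (n≤0⇒n≡0 (m+n≤o⇒m≤o (weight u) le)) u≢0
∈-seqs (suc n) (u ∷ s) (u≢0 , p) le =
  there (∈-cartesianProductWith⁺ _∷_ (∈-vecs u (m+n≤o⇒m≤o (weight u) le))
    -- At least 1 of the bound `suc n` is spent on `u`, which leaves at most `n` for `s`.
    (∈-seqs n s p (≤-pred (≤-trans (+-monoˡ-≤ (totalˢ s) (n≢0⇒n>0 u≢0)) le))))

SeqOf-finite : ∀ n k → ∃ (HasCardinality (SeqOf n k))
SeqOf-finite n k = listed⇒finite _≟ˢ_ (SeqOf? n k) (seqs n 0)
  λ {s} x → let open SeqOf x in ∈-seqs n s valid (≤-reflexive total≡)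

-- Row-Fishburn matrices as sequences

sum≢0⇒∃ : (f : Fin m → ℕ) → sum f ≢ 0 → ∃ λ i → f i ≢ 0
sum≢0⇒∃ {zero}  f p = contradiction refl p
sum≢0⇒∃ {suc m} f p with f zero ≟ 0
... | no  f₀≢0 = zero , f₀≢0
... | yes f₀≡0 with i , q ← sum≢0⇒∃ (λ i → f (suc i)) (λ eq → p (cong₂ _+_ f₀≡0 eq)) = suc i , q

∃⇒sum≢0 : (f : Fin m → ℕ) → (∃ λ i → f i ≢ 0) → sum f ≢ 0
∃⇒sum≢0 f (zero  , p) eq = p (m+n≡0⇒m≡0 _ eq)
∃⇒sum≢0 f (suc i , p) eq = ∃⇒sum≢0 (λ i → f (suc i)) (i , p) (m+n≡0⇒n≡0 (f zero) eq)

addRow : Vec ℕ (suc r) → Matrix r → Matrix (suc r)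
addRow u B = u ∷ map (0 ∷_) B

map-tail-map-0∷ : (B : Vec (Vec ℕ m) r) → map tail (map (0 ∷_) B) ≡ B
map-tail-map-0∷ B = trans (sym (map-∘ tail (0 ∷_) B)) (map-id B)

map-0∷-map-tail : (B : Vec (Vec ℕ (suc m)) r) → (∀ i → lookup (lookup B i) zero ≡ 0) →
                  map (0 ∷_) (map tail B) ≡ B
map-0∷-map-tail []            eq = refl
map-0∷-map-tail ((x ∷ b) ∷ B) eq =
  cong₂ _∷_ (cong (_∷ b) (sym (eq zero))) (map-0∷-map-tail B (λ i → eq (suc i)))

lookup-tail : (v : Vec ℕ (suc r)) (j : Fin r) → lookup (tail v) j ≡ lookup v (suc j)
lookup-tail (_ ∷ v) j = refl

record RowFishburn (M : Matrix r) : Set where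
  constructor _,_
  field
    upperTriangular : UpperTriangular M
    rowSum≢0        : ∀ i → rowSum M i ≢ 0

rowSum-addRow : (u : Vec ℕ (suc r)) (B : Matrix r) (i : Fin r) →
                rowSum (addRow u B) (suc i) ≡ rowSum B i
rowSum-addRow u B i = sum-cong-≗ λ j → cong (λ v → lookup v j) (lookup-map i (0 ∷_) B)

RowFishburn-addRow : (u : Vec ℕ (suc r)) (B : Matrix r) →
  weight u ≢ 0 → RowFishburn B → RowFishburn (addRow u B)
RowFishburn-addRow {r} u B u≢0 (ut , nz) = ut′ , nz′
  where
  ut′ : UpperTriangular (addRow u B)
  ut′ (suc i) zero    _       = cong (λ v → lookup v zero) (lookup-map i (0 ∷_) B)
  ut′ (suc i) (suc j) (s≤s p) =
    trans (cong (λ v → lookup v (suc j)) (lookup-map i (0 ∷_) B)) (ut i j p)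
  nz′ : ∀ i → rowSum (addRow u B) i ≢ 0
  nz′ zero    = u≢0
  nz′ (suc i) = subst (_≢ 0) (sym (rowSum-addRow u B i)) (nz i)

RowFishburn-tail : (u : Vec ℕ (suc r)) (B : Vec (Vec ℕ (suc r)) r) →
  RowFishburn (u ∷ B) → RowFishburn (map tail B)
RowFishburn-tail u B (ut , nz) = ut′ , nz′
  where
  entry-tail : ∀ i j → entry (map tail B) i j ≡ lookup (lookup B i) (suc j)
  entry-tail i j = trans (cong (λ v → lookup v j) (lookup-map i tail B)) (lookup-tail (lookup B i) j)
  ut′ : UpperTriangular (map tail B)
  ut′ i j p = trans (entry-tail i j) (ut (suc i) (suc j) (s≤s p))
  nz′ : ∀ i → rowSum (map tail B) i ≢ 0
  nz′ i eq = nz (suc i)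
    (cong₂ _+_ (ut (suc i) zero (s≤s z≤n)) (trans (sym (sum-cong-≗ (entry-tail i))) eq))

UpperTriangular⇒column₀ : (u : Vec ℕ (suc r)) (B : Vec (Vec ℕ (suc r)) r) →
  UpperTriangular (u ∷ B) → map (0 ∷_) (map tail B) ≡ B
UpperTriangular⇒column₀ u B ut = map-0∷-map-tail B λ i → ut (suc i) zero (s≤s z≤n)

-- `B` accumulates the lower right block from the vectors read so far, as in list reversal;
-- `disassemble` runs the same process backwards.
assemble : Matrix (suc r) → Seq (suc r) → SquareMatrix
assemble B []      = _ , B
assemble B (u ∷ s) = assemble (addRow u B) s

-- The empty sequence gets a junk value.
assemble₀ : Seq 0 → SquareMatrix
assemble₀ []      = 0 , (0 ∷ []) ∷ []
assemble₀ (u ∷ s) = assemble (addRow u []) s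

disassemble : ∀ r → Matrix r → Seq r → Seq 0
disassemble zero    []      s = s
disassemble (suc r) (u ∷ B) s = disassemble r (map tail B) (u ∷ s)

disassemble-assemble : (B : Matrix (suc r)) (s : Seq (suc r)) →
  let d , M = assemble B s in disassemble (suc d) M [] ≡ disassemble (suc r) B s
disassemble-assemble B []      = refl
disassemble-assemble B (u ∷ s) =
  trans (disassemble-assemble (addRow u B) s)
        (cong (λ B → disassemble _ B (u ∷ s)) (map-tail-map-0∷ B))

assemble₀-disassemble : ∀ r (B : Matrix (suc r)) (s : Seq (suc r)) → RowFishburn B →
  assemble₀ (disassemble (suc r) B s) ≡ assemble B s
assemble₀-disassemble zero    (u ∷ []) s p = refl
assemble₀-disassemble (suc r) (u ∷ B)  s p =
  trans (assemble₀-disassemble r (map tail B) (u ∷ s) (RowFishburn-tail u B p))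
        (cong (λ B → assemble (u ∷ B) s)
              (UpperTriangular⇒column₀ u B (RowFishburn.upperTriangular p)))

RowFishburn-assemble : (B : Matrix (suc r)) (s : Seq (suc r)) → RowFishburn B → Validˢ s →
  RowFishburn (proj₂ (assemble B s))
RowFishburn-assemble B []      p _       = p
RowFishburn-assemble B (u ∷ s) p (q , t) =
  RowFishburn-assemble (addRow u B) s (RowFishburn-addRow u B q p) t

Validˢ-disassemble : ∀ r (B : Matrix r) (s : Seq r) → RowFishburn B → Validˢ s →
  Validˢ (disassemble r B s)
Validˢ-disassemble zero    []      s p q = q
Validˢ-disassemble (suc r) (u ∷ B) s p q =
  Validˢ-disassemble r (map tail B) (u ∷ s) (RowFishburn-tail u B p)
    (RowFishburn.rowSum≢0 p zero , q)

size-assemble : (B : Matrix (suc r)) (s : Seq (suc r)) →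
  size (proj₂ (assemble B s)) ≡ size B + totalˢ s
size-assemble B []      = sym (+-identityʳ _)
size-assemble B (u ∷ s) = begin
  size (proj₂ (assemble (addRow u B) s))  ≡⟨ size-assemble (addRow u B) s ⟩
  size (addRow u B) + totalˢ s
    ≡⟨ cong (λ x → weight u + x + totalˢ s) (sum-cong-≗ (rowSum-addRow u B)) ⟩
  weight u + size B + totalˢ s            ≡⟨ cong (_+ totalˢ s) (+-comm (weight u) (size B)) ⟩
  size B + weight u + totalˢ s            ≡⟨ +-assoc (size B) (weight u) (totalˢ s) ⟩
  size B + (weight u + totalˢ s)          ∎
  where open ≡-Reasoning

lastColumn : SquareMatrix → ℕ
lastColumn (d , M) = colSum M (fromℕ d)

colSum-addRow : (u : Vec ℕ (suc r)) (B : Matrix r) (j : Fin r) →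
  colSum (addRow u B) (suc j) ≡ lookup u (suc j) + colSum B j
colSum-addRow u B j =
  cong (lookup u (suc j) +_) (sum-cong-≗ λ i → cong (λ v → lookup v (suc j)) (lookup-map i (0 ∷_) B))

-- Columns are added on the left, so the last one stays last, and each vector meets it in its final
-- entry.
lastColumn-assemble : (B : Matrix (suc r)) (s : Seq (suc r)) →
  lastColumn (assemble B s) ≡ colSum B (fromℕ r) + rowˢ s (fromℕ r)
lastColumn-assemble         B []      = sym (+-identityʳ _)
lastColumn-assemble {r} B (u ∷ s) = begin
  lastColumn (assemble (addRow u B) s)
    ≡⟨ lastColumn-assemble (addRow u B) s ⟩
  colSum (addRow u B) (suc l) + rowˢ s (suc l)
    ≡⟨ cong (_+ rowˢ s (suc l)) (trans (colSum-addRow u B l) (+-comm (lookup u (suc l)) _)) ⟩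
  colSum B l + lookup u (suc l) + rowˢ s (suc l)
    ≡⟨ +-assoc (colSum B l) _ _ ⟩
  colSum B l + (lookup u (suc l) + rowˢ s (suc l)) ∎
  where open ≡-Reasoning
        l = fromℕ r

size-assemble₀ : (s : Seq 0) → size (proj₂ (assemble₀ s)) ≡ totalˢ s
size-assemble₀ []      = refl
size-assemble₀ (u ∷ s) =
  trans (size-assemble (addRow u []) s) (cong (_+ totalˢ s) (+-identityʳ (weight u)))

lastColumn-assemble₀ : (s : Seq 0) → lastColumn (assemble₀ s) ≡ firstRowˢ s
lastColumn-assemble₀ []      = refl
lastColumn-assemble₀ (u ∷ s) =
  trans (lastColumn-assemble (addRow u []) s) (cong (_+ rowˢ s zero) (+-identityʳ (lookup u zero)))

RowFishburn-[] : RowFishburn {0} []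
RowFishburn-[] = (λ ()) , (λ ())

disassemble-assemble₀ : (s : Seq 0) → totalˢ s ≢ 0 →
  let d , M = assemble₀ s in disassemble (suc d) M [] ≡ s
disassemble-assemble₀ []      p = contradiction refl p
disassemble-assemble₀ (u ∷ s) p = disassemble-assemble (addRow u []) s

RowFishburn-assemble₀ : (s : Seq 0) → totalˢ s ≢ 0 → Validˢ s → RowFishburn (proj₂ (assemble₀ s))
RowFishburn-assemble₀ []      p _       = contradiction refl p
RowFishburn-assemble₀ (u ∷ s) p (q , t) =
  RowFishburn-assemble (addRow u []) s (RowFishburn-addRow u [] q RowFishburn-[]) t

IsRowFishburn⇒RowFishburn : {M : Matrix r} → IsRowFishburn M → RowFishburn M
IsRowFishburn⇒RowFishburn p = upperTriangular , λ i → ∃⇒sum≢0 _ (nonzeroRows i)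
  where open IsRowFishburn p

RowFishburn⇒IsRowFishburn : {M : Matrix r} → RowFishburn M → IsRowFishburn M
RowFishburn⇒IsRowFishburn (ut , nz) = record
  { upperTriangular = ut ; nonzeroRows = λ i → sum≢0⇒∃ _ (nz i) }

-- `n ≢ 0` excludes the empty sequence, which no matrix of dimension at least 1 yields.
RM≃SeqOf : ∀ {n k} → n ≢ 0 → Correspondence (RM n k) (SeqOf n k)
RM≃SeqOf {n} {k} n≢0 = record
  { to      = to
  ; from    = assemble₀
  -- Size and last column were computed for `assemble₀`; they pass to `to A` because
  -- `assemble₀ (to A)` is `A`.
  ; to-∈    = λ {A} p → let open RM p; eq = from-to p in record
      { valid     = Validˢ-disassemble _ (proj₂ A) [] (IsRowFishburn⇒RowFishburn isRowFishburn) tt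
      ; total≡    = trans (sym (size-assemble₀ (to A))) (trans (cong (λ A → size (proj₂ A)) eq) size≡)
      ; firstRow≡ = trans (sym (lastColumn-assemble₀ (to A))) (trans (cong lastColumn eq) lastColumnSum≡)
      }
  ; from-∈  = λ {s} p → let open SeqOf p in mkRM
      (RowFishburn⇒IsRowFishburn (RowFishburn-assemble₀ s (total≢0 p) valid))
      (trans (size-assemble₀ s) total≡)
      (trans (lastColumn-assemble₀ s) firstRow≡)
  ; from-to = from-to
  ; to-from = λ {s} p → disassemble-assemble₀ s (total≢0 p)
  }
  where
  to : SquareMatrix → Seq 0
  to (d , M) = disassemble (suc d) M []
  total≢0 : ∀ {s} → SeqOf n k s → totalˢ s ≢ 0
  total≢0 p eq = n≢0 (trans (sym (SeqOf.total≡ p)) eq)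
  from-to : ∀ {A} → RM n k A → assemble₀ (to A) ≡ A
  from-to {d , M} p =
    assemble₀-disassemble d M [] (IsRowFishburn⇒RowFishburn (RM.isRowFishburn p))

-- Indices relative to the outer frame of a matrix

middle : Fin m → Fin (2 + m)
middle i = suc (inject₁ i)

final : Fin (suc m)
final = fromℕ _

data Ends : Fin (2 + m) → Set where
  isFirst  : Ends {m} zero
  isMiddle : (i : Fin m) → Ends (middle i)
  isFinal  : Ends {m} final

ends : (i : Fin (2 + m)) → Ends i
ends zero    = isFirst
ends (suc i) with view i
... | ‵fromℕ     = isFinal
... | ‵inject₁ j = isMiddle j

-- `ends` is stuck on `middle i` and `final`; rewriting with this lemma and the next makes `extend`
-- and `square` compute there.
ends-middle : (i : Fin m) → ends (middle i) ≡ isMiddle i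
ends-middle i rewrite view-inject₁ i = refl

ends-final : ∀ m → ends (final {suc m}) ≡ isFinal
ends-final m rewrite view-fromℕ m = refl

extend : {A : Set} → A → (Fin m → A) → A → Fin (2 + m) → A
extend a f b i = by (ends i)
  where
  by : ∀ {i} → Ends i → _
  by isFirst      = a
  by (isMiddle j) = f j
  by isFinal      = b

opposite-inject₁ : (i : Fin m) → opposite (inject₁ i) ≡ suc (opposite i)
opposite-inject₁ zero    = refl
opposite-inject₁ (suc i) = cong inject₁ (opposite-inject₁ i)

opposite-middle : (i : Fin m) → opposite (middle i) ≡ middle (opposite i)
opposite-middle i = cong inject₁ (opposite-inject₁ i)

opposite-final : ∀ m → opposite (final {m}) ≡ zero
opposite-final zero    = refl
opposite-final (suc m) = cong inject₁ (opposite-final m)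

toℕ-middle : (i : Fin m) → toℕ (middle i) ≡ suc (toℕ i)
toℕ-middle i = cong suc (toℕ-inject₁ i)

middle<final : (i : Fin m) → middle i Fin.< final {suc m}
middle<final {m} i rewrite toℕ-middle i | toℕ-fromℕ m = s≤s (toℕ<n i)

middle-mono-< : {i j : Fin m} → j Fin.< i → middle j Fin.< middle i
middle-mono-< {i = i} {j} p rewrite toℕ-inject₁ i | toℕ-inject₁ j = s≤s p

middle-cancel-< : {i j : Fin m} → middle j Fin.< middle i → j Fin.< i
middle-cancel-< {i = i} {j} (s≤s p) rewrite toℕ-inject₁ i | toℕ-inject₁ j = p

sum-ends : (f : Fin (2 + m) → ℕ) → sum f ≡ f zero + (sum (f ∘ middle) + f final)
sum-ends f = cong (f zero +_) (sum-init-last (f ∘ suc))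

-- Self-dual matrices as pairs of columns

Entries : ℕ → ℕ → Set
Entries r m = Fin r → Fin m → ℕ

column : Entries r m → Fin m → Vec ℕ r
column E j = tabulate λ i → E i j

lookup-column : (E : Entries r m) → ∀ j i → lookup (column E j) i ≡ E i j
lookup-column E j = lookup∘tabulate λ i → E i j

weight-column : (E : Entries r m) → ∀ j → weight (column E j) ≡ ∑[ i < r ] E i j
weight-column E j = sum-cong-≗ (lookup-column E j)

column≡ : (E : Entries r m) → ∀ j {u} → (∀ i → E i j ≡ lookup u i) → column E j ≡ u
column≡ E j {u} eq = trans (tabulate-cong eq) (tabulate∘lookup u)

interior : Entries r (2 + m) → Entries r m
interior E i j = E i (middle j)

-- Stripping the frame turns the first row of the square into one more row above. It goes in front,
-- so that index `zero` is the nearest row, as in `Cols`.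
stack : Entries r (suc m) → Entries (suc m) (suc m) → Entries (suc r) (suc m)
stack E F = F zero ∷ᶠ E

inner : Entries (2 + m) (2 + m) → Entries m m
inner F i j = F (middle i) (middle j)

record UpperSelfDual (F : Entries m m) : Set where
  constructor _,_
  field
    upper    : ∀ i j → j Fin.< i → F i j ≡ 0
    selfDual : ∀ i j → F i j ≡ F (opposite j) (opposite i)

module Outer {m} {F : Entries (2 + m) (2 + m)} (p : UpperSelfDual F) where
  open UpperSelfDual p

  middle-first≡0 : ∀ i → F (middle i) zero ≡ 0
  middle-first≡0 i = upper _ _ (s≤s z≤n)

  final-first≡0 : F final zero ≡ 0
  final-first≡0 = upper _ _ (s≤s z≤n)

  final-middle≡0 : ∀ j → F final (middle j) ≡ 0
  final-middle≡0 j = upper _ _ (middle<final j)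

  middle-final : ∀ i → F (middle i) final ≡ F zero (middle (opposite i))
  middle-final i = trans (selfDual _ _)
    (cong₂ F (opposite-final (suc m)) (opposite-middle i))

  final-final : F final final ≡ F zero zero
  final-final = trans (selfDual _ _) (cong₂ F (opposite-final (suc m)) (opposite-final (suc m)))

  UpperSelfDual-inner : UpperSelfDual (inner F)
  UpperSelfDual-inner =
    (λ i j q → upper _ _ (middle-mono-< q)) ,
    (λ i j → trans (selfDual _ _) (cong₂ F (opposite-middle j) (opposite-middle i)))

-- `E` holds the rows already stripped off, restricted to the columns of the square `F` that is
-- left.
toCols : ∀ m {r} → Entries r m → Entries m m → Cols m r
toCols zero          E F = []
toCols (suc zero)    E F = end (column (stack E F) zero)
toCols (suc (suc m)) E F =
  cons (column (stack E F) zero) (column (stack E F) final) (toCols m (interior (stack E F)) (inner F))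

upperRows : Cols m r → Entries r m
upperRows []           i ()
upperRows (end u)      i = λ _ → lookup u (suc i)
upperRows (cons u v c) i =
  extend (lookup u (suc i)) (upperRows c (suc i)) (lookup v (suc i))

-- The frame below its first row is not recorded in `Cols`: upper triangularity makes it zero except
-- in the last column, which reflects the first row.
square : Cols m r → Entries m m
square []           ()
square (end u)      _ _ = lookup u zero
square (cons u v c) =
  extend (extend (lookup u zero) (upperRows c zero) (lookup v zero))
         (λ i → extend 0 (square c i) (upperRows c zero (opposite i)))
         (extend 0 (λ _ → 0) (lookup u zero))

stack-cong : {E E′ : Entries r (suc m)} {F F′ : Entries (suc m) (suc m)} →
  (∀ i j → E i j ≡ E′ i j) → (∀ i j → F i j ≡ F′ i j) → ∀ i j → stack E F i j ≡ stack E′ F′ i j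
stack-cong p q zero    j = q zero j
stack-cong p q (suc i) j = p i j

cons-cong : ∀ {u u′ v v′ : Vec ℕ (suc r)} {c c′ : Cols m (suc r)} →
  u ≡ u′ → v ≡ v′ → c ≡ c′ → cons u v c ≡ cons u′ v′ c′
cons-cong refl refl refl = refl

toCols-cong : ∀ m {r} {E E′ : Entries r m} {F F′} →
  (∀ i j → E i j ≡ E′ i j) → (∀ i j → F i j ≡ F′ i j) → toCols m E F ≡ toCols m E′ F′
toCols-cong zero          p q = refl
toCols-cong (suc zero)    p q = cong end (tabulate-cong λ i → stack-cong p q i zero)
toCols-cong (suc (suc m)) p q = cons-cong
  (tabulate-cong λ i → stack-cong p q i zero)
  (tabulate-cong λ i → stack-cong p q i final)
  (toCols-cong m (λ i j → stack-cong p q i (middle j)) (λ i j → q (middle i) (middle j)))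

toCols-square : (c : Cols m r) → toCols m (upperRows c) (square c) ≡ c
toCols-square []           = refl
toCols-square c@(end u)    =
  cong end (column≡ (stack (upperRows c) (square c)) zero λ { zero → refl ; (suc i) → refl })
toCols-square {suc (suc m)} {r} c₀@(cons u v c) =
  cons-cong (column≡ E zero λ { zero → refl ; (suc i) → refl })
            (column≡ E final E-final)
            (trans (toCols-cong m E-middle inner-square) (toCols-square c))
  where
  E : Entries (suc r) (2 + m)
  E = stack (upperRows c₀) (square c₀)
  E-final : ∀ i → E i final ≡ lookup v i
  E-final zero    rewrite ends-final m = refl
  E-final (suc i) rewrite ends-final m = refl
  E-middle : ∀ i j → E i (middle j) ≡ upperRows c i j
  E-middle zero    j rewrite ends-middle j = refl
  E-middle (suc i) j rewrite ends-middle j = refl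
  inner-square : ∀ i j → inner (square c₀) i j ≡ square c i j
  inner-square i j rewrite ends-middle i | ends-middle j = refl

upperRows-toCols : ∀ m {r} (E : Entries r m) F → ∀ i j → upperRows (toCols m E F) i j ≡ E i j
upperRows-toCols (suc zero)    E F i zero = lookup-column (stack E F) zero (suc i)
upperRows-toCols (suc (suc m)) E F i j    = by (ends j)
  where
  by : ∀ {j} → Ends j → upperRows (toCols (2 + m) E F) i j ≡ E i j
  by isFirst      = lookup-column (stack E F) zero (suc i)
  by (isMiddle j) rewrite ends-middle j =
    upperRows-toCols m (interior (stack E F)) (inner F) (suc i) j
  by isFinal      rewrite ends-final m = lookup-column (stack E F) final (suc i)

square-toCols : ∀ m {r} (E : Entries r m) F → UpperSelfDual F →
                ∀ i j → square (toCols m E F) i j ≡ F i j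
square-toCols (suc zero)    E F p zero zero = refl
square-toCols (suc (suc m)) E F p i    j    = by (ends i) (ends j)
  where
  open Outer p
  E′ : Entries _ m
  E′ = interior (stack E F)

  by : ∀ {i j} → Ends i → Ends j → square (toCols (2 + m) E F) i j ≡ F i j
  by isFirst      isFirst      = refl
  by isFirst      (isMiddle j) rewrite ends-middle j = upperRows-toCols m E′ (inner F) zero j
  by isFirst      isFinal      rewrite ends-final m = refl
  by (isMiddle i) isFirst      rewrite ends-middle i = sym (middle-first≡0 i)
  by (isMiddle i) (isMiddle j) rewrite ends-middle i | ends-middle j =
    square-toCols m E′ (inner F) UpperSelfDual-inner i j
  by (isMiddle i) isFinal      rewrite ends-middle i | ends-final m =
    trans (upperRows-toCols m E′ (inner F) zero (opposite i)) (sym (middle-final i))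
  by isFinal      isFirst      rewrite ends-final m = sym final-first≡0
  by isFinal      (isMiddle j) rewrite ends-final m | ends-middle j = sym (final-middle≡0 j)
  by isFinal      isFinal      rewrite ends-final m | ends-final m = sym final-final

square-upper : (c : Cols m r) → ∀ i j → j Fin.< i → square c i j ≡ 0
square-upper (end u)      zero    zero    ()
square-upper {suc (suc m)} (cons u v c) i j p = by (ends i) (ends j) p
  where
  by : ∀ {i j} → Ends i → Ends j → j Fin.< i → square (cons u v c) i j ≡ 0
  by isFirst      _            ()
  by (isMiddle i) isFirst      _ rewrite ends-middle i = refl
  by (isMiddle i) (isMiddle j) p rewrite ends-middle i | ends-middle j =
    square-upper c i j (middle-cancel-< p)
  by (isMiddle i) isFinal      p = contradiction p (<-asym (middle<final i))
  by isFinal      isFirst      _ rewrite ends-final m = refl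
  by isFinal      (isMiddle j) _ rewrite ends-final m | ends-middle j = refl
  by isFinal      isFinal      p = contradiction p (<-irrefl refl)

square-selfDual : (c : Cols m r) → ∀ i j → square c i j ≡ square c (opposite j) (opposite i)
square-selfDual (end u) zero zero = refl
square-selfDual {suc (suc m)} (cons u v c) i j = by (ends i) (ends j)
  where
  by : ∀ {i j} → Ends i → Ends j →
       square (cons u v c) i j ≡ square (cons u v c) (opposite j) (opposite i)
  by isFirst      isFirst      rewrite ends-final m | ends-final m = refl
  by isFirst      (isMiddle j)
    rewrite opposite-middle j | ends-middle j | ends-middle (opposite j) | ends-final m
          | opposite-involutive j = refl
  by isFirst      isFinal      rewrite opposite-final m | ends-final m = refl
  by (isMiddle i) isFirst
    rewrite opposite-middle i | ends-middle i | ends-final m | ends-middle (opposite i) = refl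
  by (isMiddle i) (isMiddle j)
    rewrite opposite-middle i | opposite-middle j | ends-middle i | ends-middle j
          | ends-middle (opposite j) | ends-middle (opposite i) = square-selfDual c i j
  by (isMiddle i) isFinal
    rewrite opposite-middle i | opposite-final m | ends-middle i | ends-final m
          | ends-middle (opposite i) = refl
  by isFinal      isFirst      rewrite opposite-final m | ends-final m = refl
  by isFinal      (isMiddle j)
    rewrite opposite-middle j | opposite-final m | ends-final m | ends-middle j
          | ends-middle (opposite j) = refl
  by isFinal      isFinal      rewrite opposite-final m | ends-final m | ends-final m = refl

UpperSelfDual-square : (c : Cols m r) → UpperSelfDual (square c)
UpperSelfDual-square c = square-upper c , square-selfDual c

-- Reduced size and row sums

cell : Entries m m → Entries m m
cell F i j = if does (diagonalOrNWCell? i j) then F i j else 0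

-- Chosen so that `reduced (entry M)` is `reducedSize M` by definition.
reduced : Entries m m → ℕ
reduced {m} F = ∑[ i < m ] ∑[ j < m ] cell F i j

cell-in : (F : Entries m m) → ∀ i j → number i + number j ≤ m + 1 → cell F i j ≡ F i j
cell-in F i j p = cong (if_then F i j else 0) (dec-true (diagonalOrNWCell? i j) (in-region p))
  where
  in-region : _ ≤ _ → DiagonalCell i j ⊎ NWCell i j
  in-region p with m≤n⇒m<n∨m≡n p
  ... | inj₁ lt = inj₂ lt
  ... | inj₂ eq = inj₁ eq

cell-out : (F : Entries m m) → ∀ i j → m + 1 < number i + number j → cell F i j ≡ 0
cell-out F i j p = cong (if_then F i j else 0) (dec-false (diagonalOrNWCell? i j) λ where
  (inj₁ eq) → <-irrefl (sym eq) p
  (inj₂ lt) → <-asym lt p)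

cell-0 : (F : Entries m m) → ∀ i j → F i j ≡ 0 → cell F i j ≡ 0
cell-0 F i j eq with does (diagonalOrNWCell? i j)
... | true  = eq
... | false = refl

-- Both indices grow by 1 and the dimension by 2, so a cell keeps its side of the antidiagonal.
cell-middle : (F : Entries (2 + m) (2 + m)) → ∀ i j → cell F (middle i) (middle j) ≡ cell (inner F) i j
cell-middle {m} F i j = cong (if_then inner F i j else 0) (does-⇔
  (mk⇔ (λ { (inj₁ p) → inj₁ (suc-injective (suc-injective (trans (sym shift) p)))
          ; (inj₂ p) → inj₂ (≤-pred (≤-pred (subst (_< 2 + m + 1) shift p))) })
       (λ { (inj₁ p) → inj₁ (trans shift (cong (2 +_) p))
          ; (inj₂ p) → inj₂ (subst (_< 2 + m + 1) (sym shift) (s≤s (s≤s p))) }))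
  (diagonalOrNWCell? (middle i) (middle j)) (diagonalOrNWCell? i j))
  where
  shift : number (middle i) + number (middle j) ≡ 2 + (number i + number j)
  shift rewrite toℕ-inject₁ i | toℕ-inject₁ j = cong (2 +_) (+-suc (toℕ i) (suc (toℕ j)))

final-out : (i : Fin (suc m)) → (2 + m) + 1 < number (suc i) + number (final {suc m})
final-out {m} i rewrite toℕ-fromℕ m | +-comm m 1 = s≤s (s≤s (m≤n+m (2 + m) (toℕ i)))

-- The first row lies in the region entirely, ending in a diagonal cell. The rest of the frame is
-- zero by upper triangularity or consists of SE-cells.
reduced-outer : {F : Entries (2 + m) (2 + m)} → UpperSelfDual F →
                reduced F ≡ sum (F zero) + reduced (inner F)
reduced-outer {m} {F} p = begin
  reduced F
    ≡⟨ sum-ends (λ i → sum (cell F i)) ⟩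
  sum (cell F zero) + (sum (λ i → sum (cell F (middle i))) + sum (cell F final))
    ≡⟨ cong₂ _+_ (sum-cong-≗ λ j → cell-in F zero j (first-in j))
         (cong₂ _+_ (sum-cong-≗ middle-row) final-row) ⟩
  sum (F zero) + (reduced (inner F) + 0)
    ≡⟨ cong (sum (F zero) +_) (+-identityʳ _) ⟩
  sum (F zero) + reduced (inner F) ∎
  where
  open ≡-Reasoning
  open Outer p
  first-in : (j : Fin (2 + m)) → 1 + number j ≤ (2 + m) + 1
  first-in j rewrite +-comm m 1 = s≤s (toℕ<n j)

  middle-row : ∀ i → sum (cell F (middle i)) ≡ sum (cell (inner F) i)
  middle-row i = begin
    sum (cell F (middle i))
      ≡⟨ sum-ends (cell F (middle i)) ⟩
    cell F (middle i) zero + (sum (λ j → cell F (middle i) (middle j)) + cell F (middle i) final)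
      ≡⟨ cong₂ _+_ (cell-0 F (middle i) zero (middle-first≡0 i))
           (cong₂ _+_ (sum-cong-≗ (cell-middle F i)) (cell-out F (middle i) final (final-out (inject₁ i)))) ⟩
    sum (cell (inner F) i) + 0
      ≡⟨ +-identityʳ _ ⟩
    sum (cell (inner F) i) ∎

  final-row : sum (cell F final) ≡ 0
  final-row = begin
    sum (cell F final)
      ≡⟨ sum-ends (cell F final) ⟩
    cell F final zero + (sum (λ j → cell F final (middle j)) + cell F final final)
      ≡⟨ cong₂ _+_ (cell-0 F final zero final-first≡0)
           (cong₂ _+_ (sum-cong-≗ λ j → cell-0 F final (middle j) (final-middle≡0 j))
                      (cell-out F final final (final-out final))) ⟩
    sum {m} (λ _ → 0) + 0
      ≡⟨ cong (_+ 0) (sum-replicate-zero m) ⟩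
    0 ∎

row-toCols : ∀ m {r} (E : Entries r m) F → ∀ i → row (toCols m E F) i ≡ sum (E i)
row-toCols zero          E F i = refl
row-toCols (suc zero)    E F i =
  trans (lookup-column (stack E F) zero (suc i)) (sym (+-identityʳ (E i zero)))
row-toCols (suc (suc m)) E F i = begin
  row (toCols (2 + m) E F) i
    ≡⟨ cong₂ _+_ (lookup-column (stack E F) zero (suc i))
         (cong₂ _+_ (lookup-column (stack E F) final (suc i))
                    (row-toCols m (interior (stack E F)) (inner F) (suc i))) ⟩
  E i zero + (E i final + sum (E i ∘ middle))
    ≡⟨ cong (E i zero +_) (+-comm (E i final) _) ⟩
  E i zero + (sum (E i ∘ middle) + E i final)
    ≡⟨ sum-ends (E i) ⟨
  sum (E i) ∎
  where open ≡-Reasoning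

sum-sum-ends : (E : Entries r (2 + m)) →
  ∑[ i < r ] sum (E i) ≡ ∑[ i < r ] E i zero + (∑[ i < r ] sum (interior E i) + ∑[ i < r ] E i final)
sum-sum-ends {r} E = begin
  ∑[ i < r ] sum (E i)
    ≡⟨ sum-cong-≗ (λ i → sum-ends (E i)) ⟩
  ∑[ i < r ] (E i zero + (sum (interior E i) + E i final))
    ≡⟨ ∑-distrib-+ (λ i → E i zero) (λ i → sum (interior E i) + E i final) ⟩
  ∑[ i < r ] E i zero + ∑[ i < r ] (sum (interior E i) + E i final)
    ≡⟨ cong (∑[ i < r ] E i zero +_) (∑-distrib-+ (λ i → sum (interior E i)) (λ i → E i final)) ⟩
  ∑[ i < r ] E i zero + (∑[ i < r ] sum (interior E i) + ∑[ i < r ] E i final) ∎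
  where open ≡-Reasoning

-- All of `E` counts, since over the remaining columns the stripped rows lie in the region. In the
-- induction step the first row of `F` moves over to `E`.
total-toCols : ∀ m {r} (E : Entries r m) F → UpperSelfDual F →
               total (toCols m E F) ≡ ∑[ i < r ] sum (E i) + reduced F
total-toCols zero {r} E F p = sym (trans (+-identityʳ _) (sum-replicate-zero r))
total-toCols (suc zero) {r} E F p = begin
  weight (column (stack E F) zero)
    ≡⟨ weight-column (stack E F) zero ⟩
  F zero zero + ∑[ i < r ] E i zero
    ≡⟨ +-comm (F zero zero) _ ⟩
  ∑[ i < r ] E i zero + F zero zero
    ≡⟨ cong₂ _+_ (sum-cong-≗ λ i → sym (+-identityʳ (E i zero)))
         (sym (trans (+-identityʳ (F zero zero + 0)) (+-identityʳ (F zero zero)))) ⟩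
  ∑[ i < r ] sum (E i) + reduced F ∎
  where open ≡-Reasoning
total-toCols (suc (suc m)) {r} E F p = begin
  total (toCols (2 + m) E F)
    ≡⟨ cong₂ _+_ (weight-column E′ zero)
         (cong₂ _+_ (weight-column E′ final)
                    (total-toCols m (interior E′) (inner F) (Outer.UpperSelfDual-inner p))) ⟩
  ∑[ i < suc r ] E′ i zero + (∑[ i < suc r ] E′ i final + (∑[ i < suc r ] sum (interior E′ i) + R))
    ≡⟨ regroup₁ (∑[ i < suc r ] E′ i zero) (∑[ i < suc r ] E′ i final) _ R ⟩
  (∑[ i < suc r ] E′ i zero + (∑[ i < suc r ] sum (interior E′ i) + ∑[ i < suc r ] E′ i final)) + R
    ≡⟨ cong (_+ R) (sym (sum-sum-ends E′)) ⟩
  (sum (F zero) + ∑[ i < r ] sum (E i)) + R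
    ≡⟨ regroup₂ (sum (F zero)) (∑[ i < r ] sum (E i)) R ⟩
  ∑[ i < r ] sum (E i) + (sum (F zero) + R)
    ≡⟨ cong (∑[ i < r ] sum (E i) +_) (sym (reduced-outer p)) ⟩
  ∑[ i < r ] sum (E i) + reduced F ∎
  where
  open ≡-Reasoning
  E′ : Entries (suc r) (2 + m)
  E′ = stack E F
  R : ℕ
  R = reduced (inner F)
  regroup₁ : ∀ a b c d → a + (b + (c + d)) ≡ (a + (c + b)) + d
  regroup₁ = solve-∀
  regroup₂ : ∀ a b c → (a + b) + c ≡ b + (a + c)
  regroup₂ = solve-∀

-- Nonzero rows and validity

-- Generalises the absence of zero rows in F, the case r = 0, in such a way that it
-- can be restricted to the inner matrix: what the outer columns contribute to a
-- row of F by self-duality lies in a column of the rows above.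
Supported : Entries r m → Entries m m → Set
Supported {r} {m} E F = ∀ i → sum (F i) + ∑[ e < r ] E e (opposite i) ≢ 0

module Support {m r} (E : Entries r (2 + m)) {F : Entries (2 + m) (2 + m)} (p : UpperSelfDual F) where
  open Outer p
  open ≡-Reasoning

  E′ : Entries (suc r) (2 + m)
  E′ = stack E F
  u v : Vec ℕ (suc r)
  u = column E′ zero
  v = column E′ final
  c : Cols m (suc r)
  c = toCols m (interior E′) (inner F)

  -- `opposite zero` is the last column, whose part in `E` is the tail of `v`: the reflected
  -- SE-cells of the row.
  support-first : sum (F zero) + ∑[ e < r ] E e final ≡ hook u v c
  support-first = begin
    sum (F zero) + col
      ≡⟨ cong (_+ col) (sum-ends (F zero)) ⟩
    F zero zero + (sum (F zero ∘ middle) + F zero final) + col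
      ≡⟨ regroup (F zero zero) (sum (F zero ∘ middle)) (F zero final) col ⟩
    F zero zero + ((F zero final + col) + sum (F zero ∘ middle))
      ≡⟨ cong (F zero zero +_) (cong₂ _+_ (weight-column E′ final)
           (row-toCols m (interior E′) (inner F) zero)) ⟨
    hook u v c ∎
    where
    col : ℕ
    col = ∑[ e < r ] E e final
    regroup : ∀ a b c d → a + (b + c) + d ≡ a + ((c + d) + b)
    regroup = solve-∀

  -- Only the corner can be nonzero in the last row. It reflects onto the head of `u`, and the first
  -- column of `E` is the tail of `u`.
  support-final : sum (F final) + ∑[ e < r ] E e (opposite (final {suc m})) ≡ weight u
  support-final = begin
    sum (F final) + ∑[ e < r ] E e (opposite (final {suc m}))
      ≡⟨ cong₂ _+_ final-row (sum-cong-≗ λ e → cong (E e) (opposite-final (suc m))) ⟩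
    F zero zero + ∑[ e < r ] E e zero
      ≡⟨ weight-column E′ zero ⟨
    weight u ∎
    where
    final-row : sum (F final) ≡ F zero zero
    final-row = begin
      sum (F final)
        ≡⟨ sum-ends (F final) ⟩
      F final zero + (sum (F final ∘ middle) + F final final)
        ≡⟨ cong₂ _+_ final-first≡0
             (cong₂ _+_ (trans (sum-cong-≗ final-middle≡0) (sum-replicate-zero m)) final-final) ⟩
      F zero zero ∎

  -- The last cell of the row reflects onto the first row of `F`, which `stack` has just added to
  -- `E`. So the condition on a middle row is the one for the inner matrix.
  support-middle : ∀ i → sum (F (middle i)) + ∑[ e < r ] E e (opposite (middle i)) ≡
                         sum (inner F i) + ∑[ e < suc r ] E′ e (middle (opposite i))
  support-middle i = begin
    sum (F (middle i)) + ∑[ e < r ] E e (opposite (middle i))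
      ≡⟨ cong₂ _+_ (sum-ends (F (middle i))) (sum-cong-≗ λ e → cong (E e) (opposite-middle i)) ⟩
    F (middle i) zero + (sum (inner F i) + F (middle i) final) + ∑[ e < r ] E e (middle (opposite i))
      ≡⟨ cong (_+ ∑[ e < r ] E e (middle (opposite i)))
           (cong₂ _+_ (middle-first≡0 i) (cong (sum (inner F i) +_) (middle-final i))) ⟩
    sum (inner F i) + F zero (middle (opposite i)) + ∑[ e < r ] E e (middle (opposite i))
      ≡⟨ +-assoc (sum (inner F i)) _ _ ⟩
    _ ∎

support-1 : (E : Entries r 1) (F : Entries 1 1) →
  sum (F zero) + ∑[ e < r ] E e zero ≡ weight (column (stack E F) zero)
support-1 {r} E F = begin
  F zero zero + 0 + ∑[ e < r ] E e zero ≡⟨ cong (_+ ∑[ e < r ] E e zero) (+-identityʳ (F zero zero)) ⟩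
  F zero zero + ∑[ e < r ] E e zero     ≡⟨ weight-column (stack E F) zero ⟨
  weight (column (stack E F) zero)      ∎
  where open ≡-Reasoning

Supported⇒Valid : ∀ m {r} (E : Entries r m) F → UpperSelfDual F → Supported E F → Valid (toCols m E F)
Supported⇒Valid zero          E F p s = tt
Supported⇒Valid (suc zero)    E F p s = subst (_≢ 0) (support-1 E F) (s zero)
Supported⇒Valid (suc (suc m)) E F p s =
  subst (_≢ 0) support-final (s final) ,
  subst (_≢ 0) support-first (s zero) ,
  Supported⇒Valid m (interior E′) (inner F) (Outer.UpperSelfDual-inner p)
    (λ i → subst (_≢ 0) (support-middle i) (s (middle i)))
  where open Support E p

Valid⇒Supported : ∀ m {r} (E : Entries r m) F → UpperSelfDual F → Valid (toCols m E F) → Supported E F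
Valid⇒Supported (suc zero)    E F p q zero = subst (_≢ 0) (sym (support-1 E F)) q
Valid⇒Supported (suc (suc m)) {r} E F p (q₁ , q₂ , q₃) i = by (ends i)
  where
  open Support E p
  by : ∀ {i} → Ends i → sum (F i) + ∑[ e < r ] E e (opposite i) ≢ 0
  by isFirst      = subst (_≢ 0) (sym support-first) q₂
  by (isMiddle i) = subst (_≢ 0) (sym (support-middle i))
    (Valid⇒Supported m (interior E′) (inner F) (Outer.UpperSelfDual-inner p) q₃ i)
  by isFinal      = subst (_≢ 0) (sym support-final) q₁

-- First row sums and the passage to matrices

noRows : Entries 0 m
noRows ()

firstRow-flatten : ∀ d (F : Entries (suc d) (suc d)) →
  firstRowˢ (flatten (suc d) (toCols (suc d) noRows F)) ≡ sum (F zero)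
firstRow-flatten zero    F = refl
firstRow-flatten (suc d) F = begin
  F zero zero + rowˢ (flattenWith d v c) zero
    ≡⟨ cong (F zero zero +_) (row-flattenWith d v c zero) ⟩
  F zero zero + (F zero final + row c zero)
    ≡⟨ cong (λ x → F zero zero + (F zero final + x)) (row-toCols d (interior E) (inner F) zero) ⟩
  F zero zero + (F zero final + sum (F zero ∘ middle))
    ≡⟨ cong (F zero zero +_) (+-comm (F zero final) _) ⟩
  F zero zero + (sum (F zero ∘ middle) + F zero final)
    ≡⟨ sum-ends (F zero) ⟨
  sum (F zero) ∎
  where
  open ≡-Reasoning
  E : Entries 1 (2 + d)
  E = stack noRows F
  v : Vec ℕ 1
  v = column E final
  c : Cols d 1
  c = toCols d (interior E) (inner F)

toMatrix : Entries m m → Matrix m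
toMatrix F = tabulate λ i → tabulate λ j → F i j

entry-toMatrix : (F : Entries m m) → ∀ i j → entry (toMatrix F) i j ≡ F i j
entry-toMatrix F i j =
  trans (cong (λ v → lookup v j) (lookup∘tabulate _ i)) (lookup∘tabulate _ j)

toMatrix-entry : {F : Entries m m} (M : Matrix m) → (∀ i j → F i j ≡ entry M i j) → toMatrix F ≡ M
toMatrix-entry M eq =
  trans (tabulate-cong λ i → trans (tabulate-cong (eq i)) (tabulate∘lookup (lookup M i)))
        (tabulate∘lookup M)

UpperSelfDual-resp : {F G : Entries m m} → (∀ i j → F i j ≡ G i j) → UpperSelfDual F → UpperSelfDual G
UpperSelfDual-resp eq (ut , sd) =
  (λ i j p → trans (sym (eq i j)) (ut i j p)) ,
  (λ i j → trans (sym (eq i j)) (trans (sd i j) (eq _ _)))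

record SelfDualFishburn (M : Matrix m) : Set where
  constructor _,_
  field
    upperSelfDual : UpperSelfDual (entry M)
    supported     : Supported noRows (entry M)

IsFishburn⇒SelfDualFishburn : {M : Matrix m} → IsFishburn M → SelfDual M → SelfDualFishburn M
IsFishburn⇒SelfDualFishburn {M = M} f sd =
  (upperTriangular , λ i j → trans (cong (λ M → entry M i j) sd) (entry-toMatrix _ i j)) ,
  λ i → subst (_≢ 0) (sym (+-identityʳ _)) (∃⇒sum≢0 _ (nonzeroRows i))
  where open IsFishburn f

SelfDualFishburn⇒SelfDual : {M : Matrix m} → SelfDualFishburn M → SelfDual M
SelfDualFishburn⇒SelfDual {M = M} ((_ , sd) , _) =
  sym (toMatrix-entry M λ i j → sym (sd i j))

-- Column `j` is the reflection of row `opposite j`, so nonzero columns come from nonzero rows.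
SelfDualFishburn⇒IsFishburn : {M : Matrix m} → SelfDualFishburn M → IsFishburn M
SelfDualFishburn⇒IsFishburn {M = M} ((ut , sd) , s) = record
  { upperTriangular = ut
  ; nonzeroRows     = rows
  ; nonzeroColumns  = λ j → let i , p = rows (opposite j) in
      opposite i , λ eq → p (trans (trans (sd _ _) (cong (entry M (opposite i)) (opposite-involutive j))) eq)
  }
  where
  rows : NonzeroRows M
  rows i = sum≢0⇒∃ _ (subst (_≢ 0) (+-identityʳ _) (s i))

colsOf : ∀ {d} → Matrix (suc d) → Cols (suc d) 0
colsOf M = toCols _ noRows (entry M)

flattenMatrix : SquareMatrix → Seq 0
flattenMatrix (d , M) = flatten (suc d) (colsOf M)

square-colsOf : ∀ {d} {M : Matrix (suc d)} → SelfDualFishburn M → toMatrix (square (colsOf M)) ≡ M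
square-colsOf {M = M} (p , _) = toMatrix-entry M (square-toCols _ noRows (entry M) p)

colsOf-square : ∀ {d} (c : Cols (suc d) 0) → colsOf (toMatrix (square c)) ≡ c
colsOf-square c = trans (toCols-cong _ (λ ()) (entry-toMatrix (square c))) (toCols-square c)

SelfDualFishburn-square : ∀ {d} (c : Cols (suc d) 0) → Valid c → SelfDualFishburn (toMatrix (square c))
SelfDualFishburn-square c p = usd , Valid⇒Supported _ noRows _ usd (subst Valid (sym (colsOf-square c)) p)
  where usd = UpperSelfDual-resp (λ i j → sym (entry-toMatrix (square c) i j)) (UpperSelfDual-square c)

total-flattenMatrix : ∀ {d} {M : Matrix (suc d)} → SelfDualFishburn M →
  totalˢ (flattenMatrix (d , M)) ≡ reducedSize M
total-flattenMatrix {d} {M} (p , _) =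
  trans (total-flatten (suc d) (colsOf M)) (total-toCols (suc d) noRows (entry M) p)

-- Junk value outside dimensions at least 1.
fromPrefixed : Maybe (PrefixedCols 0) → SquareMatrix
fromPrefixed (just (_ , suc d , c)) = d , toMatrix (square c)
fromPrefixed _                      = 0 , (0 ∷ []) ∷ []

-- Self-dual Fishburn matrices of given parity as sequences

record SelfDualOfParity (b : Parity) (n k : ℕ) (A : SquareMatrix) : Set where
  constructor _,_
  field
    isSelfDualFishburn : IsSelfDualFishburn n k (proj₂ A)
    parity≡            : parity (suc (proj₁ A)) ≡ b

selfDualFishburn : ∀ {n k d} {M : Matrix (suc d)} → IsSelfDualFishburn n k M → SelfDualFishburn M
selfDualFishburn p = IsFishburn⇒SelfDualFishburn isFishburn selfDual
  where open IsSelfDualFishburn p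

SelfDualOfParity≃SeqOf : ∀ b {n k} → n ≢ 0 → Correspondence (SelfDualOfParity b n k) (SeqOf n k)
SelfDualOfParity≃SeqOf b {n} {k} n≢0 = record
  { to      = flattenMatrix
  ; from    = from
  ; to-∈    = λ { {d , M} (p , _) → let open IsSelfDualFishburn p; sdf = selfDualFishburn p in record
      { valid     = Valid-flatten (suc d) (colsOf M) (valid sdf)
      ; total≡    = trans (total-flattenMatrix sdf) reducedSize≡
      ; firstRow≡ = trans (firstRow-flatten d (entry M)) firstRowSum≡
      } }
  ; from-∈  = from-∈
  ; from-to = λ { {d , M} (p , refl) →
      trans (cong fromPrefixed (unflatten-flatten (suc d) (colsOf M) (valid (selfDualFishburn p))))
            (cong (d ,_) (square-colsOf (selfDualFishburn p))) }
  ; to-from = to-from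
  }
  where
  from : Seq 0 → SquareMatrix
  from s = fromPrefixed (unflatten b s)

  valid : ∀ {d} {M : Matrix (suc d)} → SelfDualFishburn M → Valid (colsOf M)
  valid {M = M} (p , s) = Supported⇒Valid _ noRows (entry M) p s

  record Image (s : Seq 0) : Set where
    field
      {dimension-1} : ℕ
      cols     : Cols (suc dimension-1) 0
      isValid  : Valid cols
      parity≡  : parity (suc dimension-1) ≡ b
      flatten≡ : flatten _ cols ≡ s
      from≡    : from s ≡ (dimension-1 , toMatrix (square cols))

  -- A sequence leading to a junk value of `fromPrefixed` is empty and has total 0, against `n ≢ 0`.
  image : ∀ {s} → SeqOf n k s → Image s
  image {s} p with unflatten b s in eq | WellFormed-unflatten b s valid′ | flatten-unflatten b s valid′
    where valid′ = SeqOf.valid p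
  ... | nothing              | _       | refl = contradiction (sym (SeqOf.total≡ p)) n≢0
  ... | just ([] , zero , []) | _      | refl = contradiction (sym (SeqOf.total≡ p)) n≢0
  -- The prefix of length 0 has weight 0, so `flattenWith` reduces to `flatten` in the type of `f`.
  ... | just ([] , suc d , c) | q , v  | f    = record
    { cols = c ; isValid = v ; parity≡ = q ; flatten≡ = f ; from≡ = cong fromPrefixed eq }

  to-from : ∀ {s} → SeqOf n k s → flattenMatrix (from s) ≡ s
  to-from p = let open Image (image p) in
    trans (cong flattenMatrix from≡) (trans (cong (flatten _) (colsOf-square cols)) flatten≡)

  from-∈ : ∀ {s} → SeqOf n k s → SelfDualOfParity b n k (from s)
  from-∈ {s} p = subst (SelfDualOfParity b n k) (sym from≡) (record
    { isFishburn   = SelfDualFishburn⇒IsFishburn sdf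
    ; selfDual     = SelfDualFishburn⇒SelfDual sdf
    ; reducedSize≡ = trans (sym (total-flattenMatrix sdf)) (trans (cong totalˢ eq) (SeqOf.total≡ p))
    ; firstRowSum≡ = trans (sym (firstRow-flatten _ (entry (toMatrix (square cols)))))
                           (trans (cong firstRowˢ eq) (SeqOf.firstRow≡ p))
    } , parity≡)
    where
    open Image (image p)
    sdf = SelfDualFishburn-square cols isValid
    eq : flattenMatrix (_ , toMatrix (square cols)) ≡ s
    eq = trans (cong (flatten _) (colsOf-square cols)) flatten≡

-- Parity as divisibility, and the equality of the cardinalities

parity-even⇒2∣ : ∀ m → parity m ≡ 0ℙ → 2 ∣ m
parity-even⇒2∣ zero          _ = divides 0 refl
parity-even⇒2∣ (suc (suc m)) p with divides q eq ← parity-even⇒2∣ m p =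
  divides (suc q) (cong (2 +_) eq)

2∣⇒parity-even : ∀ {m} → 2 ∣ m → parity m ≡ 0ℙ
2∣⇒parity-even (divides q refl) = even q
  where
  even : ∀ q → parity (q * 2) ≡ 0ℙ
  even zero    = refl
  even (suc q) = even q

2∤⇒parity-odd : ∀ m → 2 ∤ m → parity m ≡ 1ℙ
2∤⇒parity-odd m p with parity m in eq
... | 0ℙ = contradiction (parity-even⇒2∣ m eq) p
... | 1ℙ = refl

⊆-⊇⇒Correspondence : {A : Set} {P Q : Pred A 0ℓ} →
  (∀ {a} → P a → Q a) → (∀ {a} → Q a → P a) → Correspondence P Q
⊆-⊇⇒Correspondence f g = record
  { to = id ; from = id ; to-∈ = f ; from-∈ = g ; from-to = λ _ → refl ; to-from = λ _ → refl }

EM≃SelfDualOfParity : ∀ {n k} → Correspondence (EM n k) (SelfDualOfParity 0ℙ n k)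
EM≃SelfDualOfParity = ⊆-⊇⇒Correspondence
  (λ (mkEM p q) → p , 2∣⇒parity-even q)
  (λ (p , q) → mkEM p (parity-even⇒2∣ _ q))

OM≃SelfDualOfParity : ∀ {n k} → Correspondence (OM n k) (SelfDualOfParity 1ℙ n k)
OM≃SelfDualOfParity = ⊆-⊇⇒Correspondence
  (λ (mkOM p q) → p , 2∤⇒parity-odd _ q)
  (λ (p , q) → mkOM p λ 2∣ → contradiction (trans (sym (2∣⇒parity-even 2∣)) q) λ ())

mainTheorem1 : ∀ (n k : ℕ) → 1 ≤ n →
    ∃ λ c → HasCardinality (EM n k) c × HasCardinality (OM n k) c × HasCardinality (RM n k) c
-- `SeqOf n k` does not mention parity, so its cardinality serves all three families.
mainTheorem1 n k 1≤n with c , finite ← SeqOf-finite n k =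
  c , cardinality-transport EM≃SelfDualOfParity (cardinality-transport (SelfDualOfParity≃SeqOf 0ℙ n≢0) finite)
    , cardinality-transport OM≃SelfDualOfParity (cardinality-transport (SelfDualOfParity≃SeqOf 1ℙ n≢0) finite)
    , cardinality-transport (RM≃SeqOf n≢0) finite
  where
  n≢0 : n ≢ 0
  n≢0 = n>0⇒n≢0 1≤n
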